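{- Let $K$ be a field of characteristic zero and let $(p_n(x))_{n\ge0}$ be any sequence of polynomials in $K[x]$ with $\deg p_n=n$. Then: (a) the relations $Qp_n(x)=p_{n-1}(x)$ for $n>0$ and $Qp_0(x)=0$ define a unique $K$-linear operator $Q$ on $K[x]$; (b) the relations $q_n(0)=\delta_{n0}$, $Qq_n(x)=q_{n-1}(x)$ for $n>0$ and $Qq_0(x)=0$ define a unique sequence of polynomials $(q_n(x))_{n\ge0}$; (c) the relation $P_xq_n(x)=p_n(x)$ defines a $K$-linear operator $P_x$ on $K[x]$, and $P_x$ is invertible and $Q$-invariant, i.e. $P_xQ=QP_x$; (d) the sum $G^{(y)}=\sum_{n=0}^{\infty}q_n(y)\,Q^{n}$ converges (when applied to any polynomial only finitely many terms are nonzero) and defines a linear map $K[x]\to K[x,y]$, and the unique $K$-linear operator $F^{(y)}:K[x]\to K[x,y]$ satisfying $F^{(y)}p_n(x)=\sum_{k=0}^{n}p_k(x)\,p_{n-k}(y)$ for all $n\ge0$ is $F^{(y)}=P_yG^{(y)}$.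
   Context: A sequence of polynomials means a sequence $(r_n(x))_{n\ge0}$ with $\deg r_n=n$. In $G^{(y)}=\sum_n q_n(y)Q^n$, $Q$ acts on the variable $x$ and $q_n(y)$ is a scalar multiplier from $K[y]$. For an operator $\phi_x$ on $K[x]$, $\phi_y$ denotes the corresponding operator acting on the variable $y$ (obtained by renaming $x$ to $y$), extended $K[x]$-linearly to $K[x,y]$; operators on $K[x]$ are extended $K[y]$-linearly to $K[x,y]$. -}

module Defs where

open import Level using (Level; _⊔_)
open import Algebra.Bundles using (CommutativeRing)
open import Algebra.Bundles.Raw using (RawRing)
open import Algebra.Apartness.Bundles using (HeytingField; HeytingCommutativeRing)
open import Algebra.Module.Bundles.Raw using (RawLeftModule)
open import Algebra.Module.Morphism.Structures using (module LeftModuleMorphisms)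
import Algebra.Definitions.RawMonoid as RawMonoidDefinitions
open import Data.Fin.Base using (toℕ)
open import Data.List.Base using (List; []; _∷_; [_]; _++_; map; foldr; replicate; length; lookup)
open import Data.Nat.Base as ℕ using (ℕ; zero; suc; _∸_)
open import Data.Nat.GeneralisedArithmetic using (iterate)
open import Data.Product using (∃; _×_; _,_)
open import Function.Definitions using (Inverseᵇ)
open import Relation.Nullary.Negation using (¬_)

-- Univariate polynomials over R as coefficient lists, constant term first.
-- Trailing zeros are allowed; equality compares all coefficients.

module Polynomial {c ℓ : Level} (R : RawRing c ℓ) where

  private module R = RawRing R

  infix  4 _≈_
  infixl 6 _+_
  infixl 7 _*_ _·_
  infix  8 -_

  Poly : Set c
  Poly = List R.Carrier

  coeff : Poly → ℕ → R.Carrier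
  coeff []      _       = R.0#
  coeff (a ∷ f) zero    = a
  coeff (a ∷ f) (suc n) = coeff f n

  _≈_ : Poly → Poly → Set ℓ
  f ≈ g = ∀ n → coeff f n R.≈ coeff g n

  _+_ : Poly → Poly → Poly
  []      + g       = g
  (a ∷ f) + []      = a ∷ f
  (a ∷ f) + (b ∷ g) = (a R.+ b) ∷ (f + g)

  -_ : Poly → Poly
  -_ = map (R.-_)

  _·_ : R.Carrier → Poly → Poly
  a · f = map (a R.*_) f

  _*_ : Poly → Poly → Poly
  []      * g = []
  (a ∷ f) * g = (a · g) + (R.0# ∷ (f * g))

  const : R.Carrier → Poly
  const a = [ a ]

  X^_ : ℕ → Poly
  X^ n = replicate n R.0# ++ [ R.1# ]

  eval : Poly → R.Carrier → R.Carrier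
  eval f a = foldr (λ b v → b R.+ a R.* v) R.0# f

  rawRing : RawRing c ℓ
  rawRing = record
    { Carrier = Poly
    ; _≈_     = _≈_
    ; _+_     = _+_
    ; _*_     = _*_
    ; -_      = -_
    ; 0#      = []
    ; 1#      = const R.1#
    }

module PolynomialOperators {c ℓ₁ ℓ₂ : Level} (K : HeytingField c ℓ₁ ℓ₂) where

  open HeytingField K using (Carrier; 0#; 1#; _#_) renaming (_≈_ to _≈ᴷ_)

  scalars : RawRing c ℓ₁
  scalars = CommutativeRing.rawRing
    (HeytingCommutativeRing.commutativeRing (HeytingField.heytingCommutativeRing K))

  open RawMonoidDefinitions (RawRing.+-rawMonoid scalars)
    using () renaming (_×_ to _×ᴷ_)

  CharacteristicZero : Set ℓ₁
  CharacteristicZero = ∀ n → ¬ (suc n ×ᴷ 1# ≈ᴷ 0#)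

  module X = Polynomial scalars

  K[x] : Set c
  K[x] = X.Poly

  -- K[x,y] is K[x][y]: the coefficients of the powers of y lie in K[x].

  module XY = Polynomial X.rawRing

  K[x,y] : Set c
  K[x,y] = XY.Poly

  inX : K[x] → K[x,y]
  inX f = XY.const f

  -- Renaming of x to y.
  inY : K[x] → K[x,y]
  inY f = map X.const f

  K[x]-module : RawLeftModule Carrier c ℓ₁
  K[x]-module = record
    { Carrierᴹ = K[x]
    ; _≈ᴹ_     = X._≈_
    ; _+ᴹ_     = X._+_
    ; _*ₗ_     = X._·_
    ; 0ᴹ       = []
    ; -ᴹ_      = X.-_
    }

  K[x,y]-module : RawLeftModule Carrier c ℓ₁
  K[x,y]-module = record
    { Carrierᴹ = K[x,y]
    ; _≈ᴹ_     = XY._≈_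
    ; _+ᴹ_     = XY._+_
    ; _*ₗ_     = λ a u → map (a X.·_) u
    ; 0ᴹ       = []
    ; -ᴹ_      = XY.-_
    }

  IsLinear : (K[x] → K[x]) → Set (c ⊔ ℓ₁)
  IsLinear = LeftModuleMorphisms.IsLeftModuleHomomorphism K[x]-module K[x]-module

  IsLinear₂ : (K[x] → K[x,y]) → Set (c ⊔ ℓ₁)
  IsLinear₂ = LeftModuleMorphisms.IsLeftModuleHomomorphism K[x]-module K[x,y]-module

  infix 4 _≗_ _≗₂_ _≗ₛ_

  _≗_ : (K[x] → K[x]) → (K[x] → K[x]) → Set (c ⊔ ℓ₁)
  φ ≗ ψ = ∀ f → φ f X.≈ ψ f

  _≗₂_ : (K[x] → K[x,y]) → (K[x] → K[x,y]) → Set (c ⊔ ℓ₁)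
  φ ≗₂ ψ = ∀ f → φ f XY.≈ ψ f

  IsInvertible : (K[x] → K[x]) → Set (c ⊔ ℓ₁)
  IsInvertible φ = ∃ λ ψ → IsLinear ψ × Inverseᵇ X._≈_ X._≈_ φ ψ

  record HasDegree (f : K[x]) (n : ℕ) : Set (ℓ₁ ⊔ ℓ₂) where
    field
      leading-nonzero : X.coeff f n # 0#
      higher-zero     : ∀ m → n ℕ.< m → X.coeff f m ≈ᴷ 0#

  record PolynomialSequence : Set (c ⊔ ℓ₁ ⊔ ℓ₂) where
    field
      term   : ℕ → K[x]
      degree : ∀ n → HasDegree (term n) n

  open PolynomialSequence public using (term)

  _≗ₛ_ : PolynomialSequence → PolynomialSequence → Set ℓ₁
  r ≗ₛ s = ∀ n → term r n X.≈ term s n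

  record Lowers (Q : K[x] → K[x]) (r : PolynomialSequence) : Set ℓ₁ where
    field
      lowers-suc  : ∀ n → Q (term r (suc n)) X.≈ term r n
      lowers-zero : Q (term r 0) X.≈ []

  -- r n evaluated at 0 is the Kronecker delta of n and 0.
  record IsNormalised (r : PolynomialSequence) : Set ℓ₁ where
    field
      at-zero : X.eval (term r 0) 0# ≈ᴷ 1#
      at-suc  : ∀ n → X.eval (term r (suc n)) 0# ≈ᴷ 0#

  open RawMonoidDefinitions (RawRing.+-rawMonoid XY.rawRing) using (sum)

  FinitelySupported : (ℕ → K[x,y]) → Set ℓ₁
  FinitelySupported t = ∃ λ N → ∀ n → N ℕ.≤ n → t n XY.≈ []

  infiniteSum : (t : ℕ → K[x,y]) → FinitelySupported t → K[x,y]
  infiniteSum t (N , _) = sum {N} (λ i → t (toℕ i))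

  -- The K[x]-linear extension to K[x,y] of φ acting on y: it sends
  -- Σⱼ uⱼ(x) yʲ to Σⱼ uⱼ(x) φ(yʲ).
  onY : (K[x] → K[x]) → K[x,y] → K[x,y]
  onY φ u = sum {length u} (λ j → inX (lookup u j) XY.* inY (φ (X.X^ toℕ j)))

  -- The n-th term q n (y) Qⁿ f of the series G applied to f.
  seriesTerm : (K[x] → K[x]) → PolynomialSequence → K[x] → ℕ → K[x,y]
  seriesTerm Q q f n = inY (term q n) XY.* inX (iterate Q f n)

  -- Σ_{k=0}^{n} p k (x) p (n - k) (y)
  convolution : PolynomialSequence → ℕ → K[x,y]
  convolution p n =
    sum {suc n} (λ k → inX (term p (toℕ k)) XY.* inY (term p (n ∸ toℕ k)))

{-# OPTIONS --safe #-}

-- A sequence r with deg r n = n is a basis of K[x], since a polynomial of degree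
-- at most n is reduced below degree n by a multiple of r n.  Hence linear maps can
-- be prescribed on r, and linear maps that agree on r are equal.  The map
-- p n ↦ p (n + 1) is a right inverse of Q, and ker Q consists of the constants; so
-- each q (n + 1) is a preimage of q n whose constant term has been removed, and
-- there is no other choice.  The operators in (c) and (d) are then determined on a
-- basis: P⁻¹ maps p n to q n, the relation P Q = Q P is checked on q, and
-- F = P_y G is checked on p, where G p n = Σₖ q k (y) p (n - k) (x).

module Submission where

open import Defs
open import Algebra.Apartness.Bundles using (HeytingCommutativeRing; HeytingField)
open import Algebra.Bundles using (CommutativeMonoid; CommutativeRing)
open import Algebra.Bundles.Raw using (RawRing)
open import Algebra.Module.Morphism.Structures using (module LeftModuleMorphisms)
open import Data.Fin.Base using (Fin; toℕ)
open import Data.Fin.Properties using (opposite-prop; toℕ≤pred[n])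
open import Data.List.Base using (List; []; _∷_; map; length; lookup)
open import Data.Nat.Base using (ℕ; zero; suc; _≤_; _<_; z≤n; s≤s; _∸_; _⊔_)
open import Data.Nat.GeneralisedArithmetic using (iterate)
open import Data.Product using (Σ-syntax; ∃!; _×_; _,_; proj₁; proj₂)
open import Data.Sum.Base using (inj₁; inj₂)
open import Function.Base using (_∘_)
import Algebra.Apartness.Properties.HeytingCommutativeRing as HeytingProperties
import Algebra.Definitions.RawMonoid as RawMonoidDefinitions
import Algebra.Properties.CommutativeMonoid.Sum as SumProperties
import Algebra.Properties.CommutativeSemigroup as CommutativeSemigroupProperties
import Algebra.Properties.Group as GroupProperties
import Algebra.Properties.Ring as RingProperties
import Data.Fin.Permutation as Permutation
import Data.Nat.Properties as ℕ
import Level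
import Relation.Binary.PropositionalEquality as ≡
import Relation.Binary.Reasoning.Setoid as SetoidReasoning

module _ {c ℓ₁ ℓ₂} (K : HeytingField c ℓ₁ ℓ₂) where

  open PolynomialOperators K
  open HeytingField K
  open CommutativeRing (HeytingCommutativeRing.commutativeRing heytingCommutativeRing)
    using (ring; +-group; +-commutativeMonoid)
  open HeytingProperties heytingCommutativeRing
    using (x-0≈x; 1#0; x#0y#0→xy#0; #-congʳ; invertibleʳ⇒#)
  open CommutativeSemigroupProperties (CommutativeMonoid.commutativeSemigroup +-commutativeMonoid)
    using (interchange)
  open GroupProperties +-group using () renaming (∙-cancelʳ to +-cancelʳ)
  open RingProperties ring using (-‿distribˡ-*; -‿distribʳ-*; -1*x≈-x; -0#≈0#)
  open SumProperties +-commutativeMonoid using (sum; sum-cong-≋; ∑-permute)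
  open SetoidReasoning setoid

  -- Finite sums of scalars.

  sum< : ℕ → (ℕ → Carrier) → Carrier
  sum< n t = sum {n} (λ i → t (toℕ i))

  sum<-cong : ∀ n {s t : ℕ → Carrier} → (∀ k → s k ≈ t k) → sum< n s ≈ sum< n t
  sum<-cong n s≈t = sum-cong-≋ {n} (λ i → s≈t (toℕ i))

  sum<-zero : ∀ n (t : ℕ → Carrier) → (∀ k → t k ≈ 0#) → sum< n t ≈ 0#
  sum<-zero zero    t t≈0 = refl
  sum<-zero (suc n) t t≈0 =
    trans (+-cong (t≈0 0) (sum<-zero n (t ∘ suc) (t≈0 ∘ suc))) (+-identityˡ 0#)

  -- Both lengths are decreased together; once one runs out, its hypothesis annihilates whatever the
  -- other still has to add. This makes the sum of a finitely supported series independent of the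
  -- cut-off.
  sum<-stable : ∀ m n (t : ℕ → Carrier) →
                (∀ k → m ≤ k → t k ≈ 0#) → (∀ k → n ≤ k → t k ≈ 0#) → sum< m t ≈ sum< n t
  sum<-stable zero    n       t t₀ _  = sym (sum<-zero n t (λ k → t₀ k z≤n))
  sum<-stable (suc m) zero    t _  t₀ = sum<-zero (suc m) t (λ k → t₀ k z≤n)
  sum<-stable (suc m) (suc n) t t₀ t₁ = +-congˡ
    (sum<-stable m n (t ∘ suc) (λ k → t₀ (suc k) ∘ s≤s) (λ k → t₁ (suc k) ∘ s≤s))

  -- Reversing `Fin (suc n)` is a permutation that replaces `toℕ i` by `n ∸ toℕ i`, and doing so
  -- twice gives `toℕ i` back because `toℕ i ≤ n`.
  sum-antidiagonal : ∀ n (t : ℕ → ℕ → Carrier) →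
    sum {suc n} (λ i → t (toℕ i) (n ∸ toℕ i)) ≈ sum {suc n} (λ i → t (n ∸ toℕ i) (toℕ i))
  sum-antidiagonal n t = trans
    (∑-permute {suc n} (λ i → t (toℕ i) (n ∸ toℕ i)) Permutation.reverse)
    (sum-cong-≋ {suc n} (λ i → reflexive (≡.cong₂ t (opposite-prop i)
      (≡.trans (≡.cong (n ∸_) (opposite-prop i)) (ℕ.m∸[m∸n]≡n (toℕ≤pred[n] i))))))

  -- Coefficients of polynomials in one and two variables.

  coeff-+ : ∀ f g n → X.coeff (f X.+ g) n ≈ X.coeff f n + X.coeff g n
  coeff-+ []      g       n       = sym (+-identityˡ _)
  coeff-+ (a ∷ f) []      n       = sym (+-identityʳ _)
  coeff-+ (a ∷ f) (b ∷ g) zero    = refl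
  coeff-+ (a ∷ f) (b ∷ g) (suc n) = coeff-+ f g n

  coeff-· : ∀ a f n → X.coeff (a X.· f) n ≈ a * X.coeff f n
  coeff-· a []      n       = sym (zeroʳ a)
  coeff-· a (b ∷ f) zero    = refl
  coeff-· a (b ∷ f) (suc n) = coeff-· a f n

  coeff-neg : ∀ f n → X.coeff (X.- f) n ≈ - X.coeff f n
  coeff-neg []      n       = sym -0#≈0#
  coeff-neg (b ∷ f) zero    = refl
  coeff-neg (b ∷ f) (suc n) = coeff-neg f n

  coeff-const* : ∀ b f n → X.coeff (X.const b X.* f) n ≈ b * X.coeff f n
  coeff-const* b f n = begin
    X.coeff (X.const b X.* f) n                 ≈⟨ coeff-+ (b X.· f) (0# ∷ []) n ⟩
    X.coeff (b X.· f) n + X.coeff (0# ∷ []) n   ≈⟨ +-cong (coeff-· b f n) (zero-coeff n) ⟩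
    b * X.coeff f n + 0#                        ≈⟨ +-identityʳ _ ⟩
    b * X.coeff f n                             ∎
    where
    zero-coeff : ∀ n → X.coeff (0# ∷ []) n ≈ 0#
    zero-coeff zero    = refl
    zero-coeff (suc n) = refl

  coeff-*const : ∀ f b n → X.coeff (f X.* X.const b) n ≈ X.coeff f n * b
  coeff-*const []      b n       = sym (zeroˡ b)
  coeff-*const (a ∷ f) b zero    = +-identityʳ (a * b)
  coeff-*const (a ∷ f) b (suc n) = coeff-*const f b n

  eval-0 : ∀ f → X.eval f 0# ≈ X.coeff f 0
  eval-0 []      = refl
  eval-0 (a ∷ f) = trans (+-congˡ (zeroˡ _)) (+-identityʳ a)

  -- The coefficient of yʲ xⁱ.
  coeff₂ : K[x,y] → ℕ → ℕ → Carrier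
  coeff₂ u j i = X.coeff (XY.coeff u j) i

  coeff₂-+ : ∀ u v j i → coeff₂ (u XY.+ v) j i ≈ coeff₂ u j i + coeff₂ v j i
  coeff₂-+ []      v       j       i = sym (+-identityˡ _)
  coeff₂-+ (f ∷ u) []      j       i = sym (+-identityʳ _)
  coeff₂-+ (f ∷ u) (g ∷ v) zero    i = coeff-+ f g i
  coeff₂-+ (f ∷ u) (g ∷ v) (suc j) i = coeff₂-+ u v j i

  coeff₂-· : ∀ a u j i → coeff₂ (map (a X.·_) u) j i ≈ a * coeff₂ u j i
  coeff₂-· a []      j       i = sym (zeroʳ a)
  coeff₂-· a (f ∷ u) zero    i = coeff-· a f i
  coeff₂-· a (f ∷ u) (suc j) i = coeff₂-· a u j i

  coeff₂-neg : ∀ u j i → coeff₂ (XY.- u) j i ≈ - coeff₂ u j i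
  coeff₂-neg []      j       i = sym -0#≈0#
  coeff₂-neg (f ∷ u) zero    i = coeff-neg f i
  coeff₂-neg (f ∷ u) (suc j) i = coeff₂-neg u j i

  coeff₂-inX*inY : ∀ f g j i → coeff₂ (inX f XY.* inY g) j i ≈ X.coeff f i * X.coeff g j
  coeff₂-inX*inY f g j i = begin
    coeff₂ (inX f XY.* inY g) j i
      ≈⟨ coeff₂-+ (map (f X.*_) (inY g)) ([] ∷ []) j i ⟩
    coeff₂ (map (f X.*_) (inY g)) j i + coeff₂ ([] ∷ []) j i
      ≈⟨ +-cong (scaled g j) (zero-coeff j) ⟩
    X.coeff f i * X.coeff g j + 0#
      ≈⟨ +-identityʳ _ ⟩
    X.coeff f i * X.coeff g j ∎
    where
    zero-coeff : ∀ j → coeff₂ ([] ∷ []) j i ≈ 0#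
    zero-coeff zero    = refl
    zero-coeff (suc j) = refl
    scaled : ∀ g j → coeff₂ (map (f X.*_) (inY g)) j i ≈ X.coeff f i * X.coeff g j
    scaled []      j       = sym (zeroʳ _)
    scaled (b ∷ g) zero    = coeff-*const f b i
    scaled (b ∷ g) (suc j) = scaled g j

  -- Multiplication recurses on its left factor, so here the induction runs along the powers of `y`;
  -- with the factors in the other order, `inX f` is a single entry and one scaling suffices.
  coeff₂-inY*inX : ∀ g f j i → coeff₂ (inY g XY.* inX f) j i ≈ X.coeff g j * X.coeff f i
  coeff₂-inY*inX []      f j       i = sym (zeroˡ _)
  coeff₂-inY*inX (b ∷ g) f zero    i = begin
    X.coeff ((X.const b X.* f) X.+ []) i         ≈⟨ coeff-+ (X.const b X.* f) [] i ⟩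
    X.coeff (X.const b X.* f) i + 0#             ≈⟨ +-identityʳ _ ⟩
    X.coeff (X.const b X.* f) i                  ≈⟨ coeff-const* b f i ⟩
    b * X.coeff f i                              ∎
  coeff₂-inY*inX (b ∷ g) f (suc j) i = coeff₂-inY*inX g f j i

  open RawMonoidDefinitions (RawRing.+-rawMonoid X.rawRing) using () renaming (sum to sumX)
  open RawMonoidDefinitions (RawRing.+-rawMonoid XY.rawRing) using () renaming (sum to sumXY)

  coeff₂-sum : ∀ {n} (t : Fin n → K[x,y]) j i → coeff₂ (sumXY t) j i ≈ sum (λ k → coeff₂ (t k) j i)
  coeff₂-sum {zero}  t j i = refl
  coeff₂-sum {suc n} t j i = trans (coeff₂-+ (t Fin.zero) _ j i)
    (+-congˡ (coeff₂-sum (λ k → t (Fin.suc k)) j i))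

  -- Linear functionals and linear operators.

  -- Operators are compared through the linear functionals given by the
  -- coefficients of their values, so K[x] and K[x,y] are treated alike.

  record IsFunctional (L : K[x] → Carrier) : Set (c Level.⊔ ℓ₁) where
    field
      cong   : ∀ f g → f X.≈ g → L f ≈ L g
      +-homo : ∀ f g → L (f X.+ g) ≈ L f + L g
      ·-homo : ∀ a f → L (a X.· f) ≈ a * L f

    []-homo : L [] ≈ 0#
    []-homo = trans (·-homo 0# []) (zeroˡ _)

    neg-homo : ∀ f → L (X.- f) ≈ - L f
    neg-homo f = begin
      L (X.- f)          ≈⟨ cong _ _ (λ n → trans (coeff-neg f n)
                              (sym (trans (coeff-· (- 1#) f n) (-1*x≈-x _)))) ⟩
      L ((- 1#) X.· f)   ≈⟨ ·-homo (- 1#) f ⟩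
      - 1# * L f         ≈⟨ -1*x≈-x (L f) ⟩
      - L f              ∎

    sum-homo : ∀ {n} (t : Fin n → K[x]) → L (sumX t) ≈ sum (λ k → L (t k))
    sum-homo {zero}  t = []-homo
    sum-homo {suc n} t = trans (+-homo (t Fin.zero) _)
      (+-congˡ (sum-homo (λ k → t (Fin.suc k))))

  open IsFunctional

  coeff-functional : ∀ n → IsFunctional (λ f → X.coeff f n)
  coeff-functional n = record
    { cong   = λ f g f≈g → f≈g n
    ; +-homo = λ f g → coeff-+ f g n
    ; ·-homo = λ a f → coeff-· a f n
    }

  zero-functional : IsFunctional (λ _ → 0#)
  zero-functional = record
    { cong   = λ _ _ _ → refl
    ; +-homo = λ _ _ → sym (+-identityˡ 0#)
    ; ·-homo = λ a _ → sym (zeroʳ a)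
    }

  +-functional : ∀ {L M} → IsFunctional L → IsFunctional M → IsFunctional (λ f → L f + M f)
  +-functional L M = record
    { cong   = λ f g f≈g → +-cong (cong L f g f≈g) (cong M f g f≈g)
    ; +-homo = λ f g → trans (+-cong (+-homo L f g) (+-homo M f g)) (interchange _ _ _ _)
    ; ·-homo = λ a f → trans (+-cong (·-homo L a f) (·-homo M a f)) (sym (distribˡ a _ _))
    }

  *ʳ-functional : ∀ {L} → IsFunctional L → ∀ b → IsFunctional (λ f → L f * b)
  *ʳ-functional L b = record
    { cong   = λ f g f≈g → *-congʳ (cong L f g f≈g)
    ; +-homo = λ f g → trans (*-congʳ (+-homo L f g)) (distribʳ b _ _)
    ; ·-homo = λ a f → trans (*-congʳ (·-homo L a f)) (*-assoc a _ b)
    }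

  sum-functional : ∀ {n} {L : Fin n → K[x] → Carrier} → (∀ k → IsFunctional (L k)) →
                   IsFunctional (λ f → sum (λ k → L k f))
  sum-functional {zero}  L = zero-functional
  sum-functional {suc n} L = +-functional (L Fin.zero) (sum-functional (λ k → L (Fin.suc k)))

  -- The standard route to linearity below: a coefficient of an operator's value is rewritten as a
  -- visibly linear expression, and linearity is carried back along that formula.
  functional-resp : ∀ {L M} → (∀ f → L f ≈ M f) → IsFunctional M → IsFunctional L
  functional-resp L≈M M = record
    { cong   = λ f g f≈g → trans (L≈M f) (trans (cong M f g f≈g) (sym (L≈M g)))
    ; +-homo = λ f g → trans (L≈M _) (trans (+-homo M f g) (sym (+-cong (L≈M f) (L≈M g))))
    ; ·-homo = λ a f → trans (L≈M _) (trans (·-homo M a f) (sym (*-congˡ (L≈M f))))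
    }

  module Linear {φ : K[x] → K[x]} (φ-linear : IsLinear φ) where

    private
      module φ = LeftModuleMorphisms.IsLeftModuleHomomorphism φ-linear

    φ-cong : ∀ f g → f X.≈ g → φ f X.≈ φ g
    φ-cong f g = φ.⟦⟧-cong

    φ-[] : φ [] X.≈ []
    φ-[] = φ.0ᴹ-homo

    functional-∘ : ∀ {L} → IsFunctional L → IsFunctional (L ∘ φ)
    functional-∘ L = record
      { cong   = λ f g f≈g → cong L _ _ (φ-cong f g f≈g)
      ; +-homo = λ f g → trans (cong L _ _ (φ.+ᴹ-homo f g)) (+-homo L _ _)
      ; ·-homo = λ a f → trans (cong L _ _ (φ.*ₗ-homo a f)) (·-homo L a _)
      }

    coeff-∘ : ∀ n → IsFunctional (λ f → X.coeff (φ f) n)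
    coeff-∘ n = functional-∘ (coeff-functional n)

  open Linear

  -- Equality, sums and multiples of polynomials are all detected by coefficients, so it is enough
  -- that each coefficient of the value is a linear functional.
  linear : ∀ {φ : K[x] → K[x]} → (∀ n → IsFunctional (λ f → X.coeff (φ f) n)) → IsLinear φ
  linear {φ} L = record
    { +ᴹ-isGroupHomomorphism = record
      { isMonoidHomomorphism = record
        { isMagmaHomomorphism = record
          { isRelHomomorphism = record { cong = λ {f} {g} f≈g n → cong (L n) f g f≈g }
          ; homo = λ f g n → trans (+-homo (L n) f g) (sym (coeff-+ (φ f) (φ g) n))
          }
        ; ε-homo = λ n → []-homo (L n)
        }
      ; ⁻¹-homo = λ f n → trans (neg-homo (L n) f) (sym (coeff-neg (φ f) n))
      }
    ; *ₗ-homo = λ a f n → trans (·-homo (L n) a f) (sym (coeff-· a (φ f) n))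
    }

  linear₂ : ∀ {Φ : K[x] → K[x,y]} → (∀ j i → IsFunctional (λ f → coeff₂ (Φ f) j i)) → IsLinear₂ Φ
  linear₂ {Φ} L = record
    { +ᴹ-isGroupHomomorphism = record
      { isMonoidHomomorphism = record
        { isMagmaHomomorphism = record
          { isRelHomomorphism = record { cong = λ {f} {g} f≈g j i → cong (L j i) f g f≈g }
          ; homo = λ f g j i → trans (+-homo (L j i) f g) (sym (coeff₂-+ (Φ f) (Φ g) j i))
          }
        ; ε-homo = λ j i → []-homo (L j i)
        }
      ; ⁻¹-homo = λ f j i → trans (neg-homo (L j i) f) (sym (coeff₂-neg (Φ f) j i))
      }
    ; *ₗ-homo = λ a f j i → trans (·-homo (L j i) a f) (sym (coeff₂-· a (Φ f) j i))
    }

  coeff₂-∘ : ∀ {Φ} → IsLinear₂ Φ → ∀ j i → IsFunctional (λ f → coeff₂ (Φ f) j i)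
  coeff₂-∘ {Φ} Φ-linear j i = record
    { cong   = λ f g f≈g → Φ.⟦⟧-cong f≈g j i
    ; +-homo = λ f g → trans (Φ.+ᴹ-homo f g j i) (coeff₂-+ (Φ f) (Φ g) j i)
    ; ·-homo = λ a f → trans (Φ.*ₗ-homo a f j i) (coeff₂-· a (Φ f) j i)
    }
    where module Φ = LeftModuleMorphisms.IsLeftModuleHomomorphism Φ-linear

  linear-∘ : ∀ {φ ψ} → IsLinear φ → IsLinear ψ → IsLinear (φ ∘ ψ)
  linear-∘ φ ψ = linear (λ n → functional-∘ ψ (coeff-∘ φ n))

  id-linear : IsLinear (λ f → f)
  id-linear = linear coeff-functional

  iterate-linear : ∀ {φ} → IsLinear φ → ∀ n → IsLinear (λ f → iterate φ f n)
  iterate-linear φ zero    = id-linear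
  -- `iterate` applies the first `φ` to the argument, so the extra factor stands on the right of the
  -- composition.
  iterate-linear φ (suc n) = linear-∘ (iterate-linear φ n) φ

  shift-linear : IsLinear (0# ∷_)
  shift-linear = linear λ where
    zero    → zero-functional
    (suc n) → coeff-functional n

  -- Induction with `L` replaced by `L ∘ (0# ∷_)`: multiplication by the variable turns each
  -- monomial into the next one. The map `h` is kept separate from the list so that the sum has the
  -- shape of the one defining `onY`.
  functional-expand : ∀ {a} {A : Set a} {L} → IsFunctional L → (h : A → Carrier) (u : List A) →
    L (map h u) ≈ sum {length u} (λ k → h (lookup u k) * L (X.X^ toℕ k))
  functional-expand L h [] = []-homo L
  functional-expand {L = L} L-functional h (a ∷ u) = begin
    L (h a ∷ map h u)
      ≈⟨ cong L-functional _ _ split ⟩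
    L ((h a X.· X.const 1#) X.+ (0# ∷ map h u))
      ≈⟨ +-homo L-functional _ _ ⟩
    L (h a X.· X.const 1#) + L (0# ∷ map h u)
      ≈⟨ +-cong (·-homo L-functional _ _)
                (functional-expand (functional-∘ shift-linear L-functional) h u) ⟩
    h a * L (X.const 1#) + sum {length u} (λ k → h (lookup u k) * L (0# ∷ X.X^ toℕ k)) ∎
    where
    split : (h a ∷ map h u) X.≈ ((h a X.· X.const 1#) X.+ (0# ∷ map h u))
    split zero    = sym (trans (+-identityʳ _) (*-identityʳ _))
    split (suc n) = refl

  -- Operators acting on `y`.

  -- The coefficient of xⁱ, as a polynomial in y (written in x).
  row : ℕ → K[x,y] → K[x]
  row i u = map (λ f → X.coeff f i) u

  coeff-row : ∀ i u j → X.coeff (row i u) j ≈ coeff₂ u j i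
  coeff-row i []      j       = refl
  coeff-row i (f ∷ u) zero    = refl
  coeff-row i (f ∷ u) (suc j) = coeff-row i u j

  -- Once the power of `x` is fixed, the sum defining `onY` is the expansion over monomials of `φ`
  -- applied to a single polynomial in `y`.
  coeff₂-onY : ∀ {φ} → IsLinear φ → ∀ u j i → coeff₂ (onY φ u) j i ≈ X.coeff (φ (row i u)) j
  coeff₂-onY {φ} φ-linear u j i = begin
    coeff₂ (onY φ u) j i
      ≈⟨ coeff₂-sum {length u} (λ k → inX (lookup u k) XY.* inY (φ (X.X^ toℕ k))) j i ⟩
    sum {length u} (λ k → coeff₂ (inX (lookup u k) XY.* inY (φ (X.X^ toℕ k))) j i)
      ≈⟨ sum-cong-≋ {length u} (λ k → coeff₂-inX*inY (lookup u k) (φ (X.X^ toℕ k)) j i) ⟩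
    sum {length u} (λ k → X.coeff (lookup u k) i * X.coeff (φ (X.X^ toℕ k)) j)
      ≈⟨ functional-expand (coeff-∘ φ-linear j) (λ f → X.coeff f i) u ⟨
    X.coeff (φ (row i u)) j ∎

  onY-linear₂ : ∀ {φ Φ} → IsLinear φ → IsLinear₂ Φ → IsLinear₂ (onY φ ∘ Φ)
  onY-linear₂ {φ} {Φ} φ-linear Φ-linear = linear₂ λ j i →
    functional-resp (λ f → coeff₂-onY φ-linear (Φ f) j i)
      (functional-∘ (row-linear i) (coeff-∘ φ-linear j))
    where
    row-linear : ∀ i → IsLinear (row i ∘ Φ)
    row-linear i = linear λ j →
      functional-resp (λ f → coeff-row i (Φ f) j) (coeff₂-∘ Φ-linear j i)

  -- Degree bounds and passage to the limit.

  DegreeBelow : ℕ → K[x] → Set ℓ₁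
  DegreeBelow n f = ∀ m → n ≤ m → X.coeff f m ≈ 0#

  degreeBelow-length : ∀ f → DegreeBelow (length f) f
  degreeBelow-length []      m       _         = refl
  degreeBelow-length (a ∷ f) (suc m) (s≤s n≤m) = degreeBelow-length f m n≤m

  degreeBelow-mono : ∀ {m n} f → m ≤ n → DegreeBelow m f → DegreeBelow n f
  degreeBelow-mono f m≤n f<m k n≤k = f<m k (ℕ.≤-trans m≤n n≤k)

  degreeBelow-resp : ∀ {n} f g → f X.≈ g → DegreeBelow n f → DegreeBelow n g
  degreeBelow-resp f g f≈g f<n k n≤k = trans (sym (f≈g k)) (f<n k n≤k)

  -- The length of a list is not invariant under X._≈_, so linearity needs the
  -- truncations to agree as soon as they exceed the degree.
  functional-limit : ∀ {L : ℕ → K[x] → Carrier} → (∀ n → IsFunctional (L n)) →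
    (∀ m n f → DegreeBelow m f → DegreeBelow n f → L m f ≈ L n f) →
    IsFunctional (λ f → L (length f) f)
  functional-limit {L} L-functional stable = record
    { cong = λ f g f≈g → trans
        (stable _ (length g) f (degreeBelow-length f)
          (degreeBelow-resp g f (sym ∘ f≈g) (degreeBelow-length g)))
        (cong (L-functional _) f g f≈g)
    ; +-homo = λ f g → let n = length f ⊔ length g in begin
        L (length (f X.+ g)) (f X.+ g)  ≈⟨ stable _ n (f X.+ g) (degreeBelow-length (f X.+ g)) (+-below f g) ⟩
        L n (f X.+ g)                   ≈⟨ +-homo (L-functional n) f g ⟩
        L n f + L n g                   ≈⟨ +-cong (stable _ n f (degreeBelow-length f) (⊔-belowˡ f g))
                                                  (stable _ n g (degreeBelow-length g) (⊔-belowʳ f g)) ⟨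
        L (length f) f + L (length g) g ∎
    ; ·-homo = λ a f → trans
        (stable _ (length f) (a X.· f) (degreeBelow-length (a X.· f))
          (λ k n≤k → trans (coeff-· a f k)
            (trans (*-congˡ (degreeBelow-length f k n≤k)) (zeroʳ a))))
        (·-homo (L-functional _) a f)
    }
    where
    ⊔-belowˡ : ∀ f g → DegreeBelow (length f ⊔ length g) f
    ⊔-belowˡ f g = degreeBelow-mono f (ℕ.m≤m⊔n _ _) (degreeBelow-length f)
    ⊔-belowʳ : ∀ f g → DegreeBelow (length f ⊔ length g) g
    ⊔-belowʳ f g = degreeBelow-mono g (ℕ.m≤n⊔m (length f) _) (degreeBelow-length g)
    +-below : ∀ f g → DegreeBelow (length f ⊔ length g) (f X.+ g)
    +-below f g k n≤k = trans (coeff-+ f g k)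
      (trans (+-cong (⊔-belowˡ f g k n≤k) (⊔-belowʳ f g k n≤k)) (+-identityˡ 0#))

  -- Polynomial sequences as bases of `K[x]`.

  #0⇒inverse : ∀ {x} → x # 0# → Σ[ y ∈ Carrier ] y * x ≈ 1#
  #0⇒inverse {x} x#0 with #⇒invertible x#0
  ... | y , y*x≈1 , _ = y , trans (*-congˡ (sym (x-0≈x x))) y*x≈1

  -- `HasDegree` asks for apartness from zero, so the inverses that enter leading coefficients of
  -- new sequences must be shown apart from zero too.
  inverse⇒#0 : ∀ {x} y → y * x ≈ 1# → y # 0#
  inverse⇒#0 {x} y y*x≈1 = invertibleʳ⇒# (x , trans (*-congʳ (x-0≈x y)) y*x≈1)

  module Basis (r : PolynomialSequence) where

    lead : ℕ → Carrier
    lead n = X.coeff (term r n) n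

    lead#0 : ∀ n → lead n # 0#
    lead#0 n = HasDegree.leading-nonzero (PolynomialSequence.degree r n)

    below : ∀ n → DegreeBelow (suc n) (term r n)
    below n = HasDegree.higher-zero (PolynomialSequence.degree r n)

    lead⁻¹ : ℕ → Carrier
    lead⁻¹ n = proj₁ (#0⇒inverse (lead#0 n))

    lead⁻¹*lead : ∀ n → lead⁻¹ n * lead n ≈ 1#
    lead⁻¹*lead n = proj₂ (#0⇒inverse (lead#0 n))

    lead*lead⁻¹ : ∀ n → lead n * lead⁻¹ n ≈ 1#
    lead*lead⁻¹ n = trans (*-comm _ _) (lead⁻¹*lead n)

    lead⁻¹#0 : ∀ n → lead⁻¹ n # 0#
    lead⁻¹#0 n = inverse⇒#0 (lead⁻¹ n) (lead⁻¹*lead n)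

    -- One elimination step, cancelling the coefficient of the `n`-th power. No degree bound on `f`
    -- is imposed, so that this is a linear operator on all of `K[x]`.
    reduce : ℕ → K[x] → K[x]
    reduce n f = f X.+ ((X.coeff f n * - lead⁻¹ n) X.· term r n)

    coeff-reduce : ∀ n f m →
      X.coeff (reduce n f) m ≈ X.coeff f m + X.coeff f n * (- lead⁻¹ n * X.coeff (term r n) m)
    coeff-reduce n f m = trans (coeff-+ f _ m)
      (+-congˡ (trans (coeff-· _ (term r n) m) (*-assoc _ _ _)))

    reduce-linear : ∀ n → IsLinear (reduce n)
    reduce-linear n = linear λ m → functional-resp (λ f → coeff-reduce n f m)
      (+-functional (coeff-functional m) (*ʳ-functional (coeff-functional n) _))

    reduce-lead : ∀ n f → X.coeff (reduce n f) n ≈ 0#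
    reduce-lead n f = begin
      X.coeff (reduce n f) n
        ≈⟨ coeff-reduce n f n ⟩
      X.coeff f n + X.coeff f n * (- lead⁻¹ n * lead n)
        ≈⟨ +-congˡ (*-congˡ (-‿distribˡ-* _ _)) ⟨
      X.coeff f n + X.coeff f n * - (lead⁻¹ n * lead n)
        ≈⟨ +-congˡ (*-congˡ (-‿cong (lead⁻¹*lead n))) ⟩
      X.coeff f n + X.coeff f n * - 1#
        ≈⟨ +-congˡ (trans (sym (-‿distribʳ-* _ _)) (-‿cong (*-identityʳ _))) ⟩
      X.coeff f n + - X.coeff f n
        ≈⟨ -‿inverseʳ _ ⟩
      0# ∎

    reduce-below : ∀ n f → DegreeBelow (suc n) f → DegreeBelow n (reduce n f)
    reduce-below n f f<1+n m n≤m with ℕ.m≤n⇒m<n∨m≡n n≤m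
    ... | inj₂ ≡.refl = reduce-lead n f
    ... | inj₁ n<m    = begin
      X.coeff (reduce n f) m
        ≈⟨ coeff-reduce n f m ⟩
      X.coeff f m + X.coeff f n * (- lead⁻¹ n * X.coeff (term r n) m)
        ≈⟨ +-cong (f<1+n m n<m) (*-congˡ (trans (*-congˡ (below n m n<m)) (zeroʳ _))) ⟩
      0# + X.coeff f n * 0#
        ≈⟨ trans (+-identityˡ _) (zeroʳ _) ⟩
      0# ∎

    -- Induction on the degree bound: the functionals agree on `reduce n f`, and the multiple of
    -- `term r n` added there contributes equally to both sides and cancels. With the zero
    -- functional as `M`, this also yields vanishing results.
    functional-unique-below : ∀ {L M} → IsFunctional L → IsFunctional M →
      ∀ n → (∀ k → k < n → L (term r k) ≈ M (term r k)) →
      ∀ f → DegreeBelow n f → L f ≈ M f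
    functional-unique-below L M zero agree f f<0 =
      trans (cong L f [] f≈[]) (trans ([]-homo L) (sym (trans (cong M f [] f≈[]) ([]-homo M))))
      where
      f≈[] : f X.≈ []
      f≈[] k = f<0 k z≤n
    functional-unique-below {L} {M} L-functional M-functional (suc n) agree f f<1+n =
      +-cancelʳ (a * L (term r n)) _ _ (begin
        L f + a * L (term r n)          ≈⟨ +-congˡ (·-homo L-functional a _) ⟨
        L f + L (a X.· term r n)        ≈⟨ +-homo L-functional f _ ⟨
        L (reduce n f)                  ≈⟨ functional-unique-below L-functional M-functional n
                                             (λ k → agree k ∘ ℕ.m<n⇒m<1+n) (reduce n f)
                                             (reduce-below n f f<1+n) ⟩
        M (reduce n f)                  ≈⟨ +-homo M-functional f _ ⟩
        M f + M (a X.· term r n)        ≈⟨ +-congˡ (·-homo M-functional a _) ⟩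
        M f + a * M (term r n)          ≈⟨ +-congˡ (*-congˡ (agree n ℕ.≤-refl)) ⟨
        M f + a * L (term r n)          ∎)
      where
      a = X.coeff f n * - lead⁻¹ n

    functional-unique : ∀ {L M} → IsFunctional L → IsFunctional M →
      (∀ n → L (term r n) ≈ M (term r n)) → ∀ f → L f ≈ M f
    functional-unique L M agree f =
      functional-unique-below L M (length f) (λ k _ → agree k) f (degreeBelow-length f)

    linear-unique : ∀ {φ ψ} → IsLinear φ → IsLinear ψ →
      (∀ n → φ (term r n) X.≈ ψ (term r n)) → φ ≗ ψ
    linear-unique φ ψ agree f n =
      functional-unique (coeff-∘ φ n) (coeff-∘ ψ n) (λ k → agree k n) f

    linear₂-unique : ∀ {Φ Ψ} → IsLinear₂ Φ → IsLinear₂ Ψ →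
      (∀ n → Φ (term r n) XY.≈ Ψ (term r n)) → Φ ≗₂ Ψ
    linear₂-unique Φ Ψ agree f j i =
      functional-unique (coeff₂-∘ Φ j i) (coeff₂-∘ Ψ j i) (λ k → agree k j i) f

    module Extension (t : ℕ → K[x]) where

      -- Expansion in the basis `r` from the top degree down, with each basis element replaced by
      -- its prescribed image. The result is the intended one only when `f` has degree below the
      -- first argument.
      truncated : ℕ → K[x] → K[x]
      truncated zero    f = []
      truncated (suc n) f = ((X.coeff f n * lead⁻¹ n) X.· t n) X.+ truncated n (reduce n f)

      coeff-truncated : ∀ n f m → X.coeff (truncated (suc n) f) m ≈
        X.coeff f n * (lead⁻¹ n * X.coeff (t n) m) + X.coeff (truncated n (reduce n f)) m
      coeff-truncated n f m = trans (coeff-+ ((X.coeff f n * lead⁻¹ n) X.· t n) (truncated n (reduce n f)) m)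
        (+-congʳ (trans (coeff-· _ (t n) m) (*-assoc _ _ _)))

      truncated-linear : ∀ n → IsLinear (truncated n)
      truncated-linear zero    = linear (λ _ → zero-functional)
      truncated-linear (suc n) = linear λ m → functional-resp (λ f → coeff-truncated n f m)
        (+-functional (*ʳ-functional (coeff-functional n) _)
                      (functional-∘ (reduce-linear n) (coeff-∘ (truncated-linear n) m)))

      -- If the top index exceeds `k`, the coefficient read off is zero and `reduce` changes
      -- nothing; if it equals `k`, the coefficient is one and `reduce` leaves zero.
      truncated-term : ∀ n k → k < n → truncated n (term r k) X.≈ t k
      truncated-term (suc n) k k<1+n m with ℕ.m≤n⇒m<n∨m≡n (ℕ.≤-pred k<1+n)
      ... | inj₁ k<n = begin
        X.coeff (truncated (suc n) (term r k)) m
          ≈⟨ coeff-truncated n (term r k) m ⟩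
        X.coeff (term r k) n * _ + X.coeff (truncated n (reduce n (term r k))) m
          ≈⟨ +-cong (trans (*-congʳ (below k n k<n)) (zeroˡ _))
                    (φ-cong (truncated-linear n) (reduce n (term r k)) (term r k) unreduced m) ⟩
        0# + X.coeff (truncated n (term r k)) m
          ≈⟨ +-identityˡ _ ⟩
        X.coeff (truncated n (term r k)) m
          ≈⟨ truncated-term n k k<n m ⟩
        X.coeff (t k) m ∎
        where
        unreduced : reduce n (term r k) X.≈ term r k
        unreduced l = trans (coeff-reduce n (term r k) l)
          (trans (+-congˡ (trans (*-congʳ (below k n k<n)) (zeroˡ _))) (+-identityʳ _))
      ... | inj₂ ≡.refl = begin
        X.coeff (truncated (suc n) (term r n)) m
          ≈⟨ coeff-truncated n (term r n) m ⟩
        lead n * (lead⁻¹ n * X.coeff (t n) m) + X.coeff (truncated n (reduce n (term r n))) m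
          ≈⟨ +-cong (sym (*-assoc _ _ _))
                    (φ-cong (truncated-linear n) (reduce n (term r n)) [] reduced m) ⟩
        lead n * lead⁻¹ n * X.coeff (t n) m + X.coeff (truncated n []) m
          ≈⟨ +-cong (*-congʳ (lead*lead⁻¹ n)) (φ-[] (truncated-linear n) m) ⟩
        1# * X.coeff (t n) m + 0#
          ≈⟨ trans (+-identityʳ _) (*-identityˡ _) ⟩
        X.coeff (t n) m ∎
        where
        reduced : reduce n (term r n) X.≈ []
        reduced l = begin
          X.coeff (reduce n (term r n)) l
            ≈⟨ coeff-reduce n (term r n) l ⟩
          X.coeff (term r n) l + lead n * (- lead⁻¹ n * X.coeff (term r n) l)
            ≈⟨ +-congˡ (*-assoc _ _ _) ⟨
          X.coeff (term r n) l + lead n * - lead⁻¹ n * X.coeff (term r n) l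
            ≈⟨ +-congˡ (*-congʳ (trans (sym (-‿distribʳ-* _ _)) (-‿cong (lead*lead⁻¹ n)))) ⟩
          X.coeff (term r n) l + - 1# * X.coeff (term r n) l
            ≈⟨ +-congˡ (-1*x≈-x _) ⟩
          X.coeff (term r n) l + - X.coeff (term r n) l
            ≈⟨ -‿inverseʳ _ ⟩
          0# ∎

      -- Both truncations take the prescribed values on the basis elements of index below `m`, and
      -- these determine a linear map on polynomials of degree below `m`.
      truncated-stable-≤ : ∀ {m n} → m ≤ n → ∀ f → DegreeBelow m f → truncated m f X.≈ truncated n f
      truncated-stable-≤ {m} {n} m≤n f f<m l = functional-unique-below
        (coeff-∘ (truncated-linear m) l) (coeff-∘ (truncated-linear n) l) m
        (λ k k<m → trans (truncated-term m k k<m l)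
                         (sym (truncated-term n k (ℕ.≤-trans k<m m≤n) l)))
        f f<m

      truncated-stable : ∀ m n f → DegreeBelow m f → DegreeBelow n f → truncated m f X.≈ truncated n f
      truncated-stable m n f f<m f<n l with ℕ.≤-total m n
      ... | inj₁ m≤n = truncated-stable-≤ m≤n f f<m l
      ... | inj₂ n≤m = sym (truncated-stable-≤ n≤m f f<n l)

      -- The length serves as a degree bound that is available without deciding equality in `K`; by
      -- `truncated-stable` any other bound gives the same value.
      extend : K[x] → K[x]
      extend f = truncated (length f) f

      extend-linear : IsLinear extend
      extend-linear = linear λ l → functional-limit
        (λ n → coeff-∘ (truncated-linear n) l)
        (λ m n f f<m f<n → truncated-stable m n f f<m f<n l)

      extend-term : ∀ n → extend (term r n) X.≈ t n
      extend-term n l = trans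
        (truncated-stable _ (suc n) (term r n) (degreeBelow-length (term r n)) (below n) l)
        (truncated-term (suc n) n ℕ.≤-refl l)

    open Extension public using (extend; extend-linear; extend-term)

  -- The lowering operator and its normalised sequence.

  centre : K[x] → K[x]
  centre f = f X.+ X.const (- X.coeff f 0)

  centre-zero : ∀ f → X.coeff (centre f) 0 ≈ 0#
  centre-zero f = trans (coeff-+ f (X.const (- X.coeff f 0)) 0) (-‿inverseʳ _)

  centre-suc : ∀ f n → X.coeff (centre f) (suc n) ≈ X.coeff f (suc n)
  centre-suc f n = trans (coeff-+ f (X.const (- X.coeff f 0)) (suc n)) (+-identityʳ _)

  module Lowering (p : PolynomialSequence) {Q : K[x] → K[x]}
                  (Q-linear : IsLinear Q) (Q-lowers : Lowers Q p) where

    open Basis p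
    open Lowers Q-lowers

    iterate-[] : ∀ n → iterate Q [] n X.≈ []
    iterate-[] n = φ-[] (iterate-linear Q-linear n)

    iterate-term : ∀ {n k} → k ≤ n → iterate Q (term p n) k X.≈ term p (n ∸ k)
    iterate-term z≤n m = refl
    iterate-term {suc n} {suc k} (s≤s k≤n) m = trans
      (φ-cong (iterate-linear Q-linear k) _ (term p n) (lowers-suc n) m)
      (iterate-term k≤n m)

    iterate-term-vanishes : ∀ {n k} → n < k → iterate Q (term p n) k X.≈ []
    iterate-term-vanishes {zero} {suc k} _ m = trans
      (φ-cong (iterate-linear Q-linear k) (Q (term p 0)) [] lowers-zero m)
      (iterate-[] k m)
    iterate-term-vanishes {suc n} {suc k} (s≤s n<k) m = trans
      (φ-cong (iterate-linear Q-linear k) _ (term p n) (lowers-suc n) m)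
      (iterate-term-vanishes n<k m)

    -- It suffices to test the basis elements of index below `n`, each of which is lowered past
    -- `term p 0` within `n` steps.
    iterate-vanishes : ∀ n f → DegreeBelow n f → iterate Q f n X.≈ []
    iterate-vanishes n f f<n m = functional-unique-below
      (coeff-∘ (iterate-linear Q-linear n) m) zero-functional n
      (λ k k<n → iterate-term-vanishes k<n m) f f<n

    Q-const : ∀ a → Q (X.const a) X.≈ []
    Q-const a = iterate-vanishes 1 (X.const a) λ where (suc m) _ → refl

    raise : K[x] → K[x]
    raise = extend (λ n → term p (suc n))

    raise-linear : IsLinear raise
    raise-linear = extend-linear (λ n → term p (suc n))

    raise-term : ∀ n → raise (term p n) X.≈ term p (suc n)
    raise-term = extend-term (λ n → term p (suc n))

    Q-raise : ∀ f → Q (raise f) X.≈ f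
    Q-raise = linear-unique (linear-∘ Q-linear raise-linear) id-linear λ n m →
      trans (φ-cong Q-linear _ (term p (suc n)) (raise-term n) m) (lowers-suc n m)

    -- raise ∘ Q is the identity up to constants, whence ker Q consists of constants.
    raise-Q : ∀ f m → X.coeff (raise (Q f)) (suc m) ≈ X.coeff f (suc m)
    raise-Q f m = functional-unique
      (functional-∘ Q-linear (coeff-∘ raise-linear (suc m))) (coeff-functional (suc m)) agree f
      where
      agree : ∀ n → X.coeff (raise (Q (term p n))) (suc m) ≈ X.coeff (term p n) (suc m)
      agree zero = begin
        X.coeff (raise (Q (term p 0))) (suc m)
          ≈⟨ φ-cong raise-linear (Q (term p 0)) [] lowers-zero (suc m) ⟩
        X.coeff (raise []) (suc m)             ≈⟨ φ-[] raise-linear (suc m) ⟩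
        0#                                     ≈⟨ below 0 (suc m) (s≤s z≤n) ⟨
        X.coeff (term p 0) (suc m)             ∎
      agree (suc n) = trans
        (φ-cong raise-linear (Q (term p (suc n))) (term p n) (lowers-suc n) (suc m))
        (raise-term n (suc m))

    -- By `raise-Q` every coefficient except the constant one can be recovered from `Q f`.
    Q-injective : ∀ f g → Q f X.≈ Q g → X.coeff f 0 ≈ X.coeff g 0 → f X.≈ g
    Q-injective f g Qf≈Qg f₀≈g₀ zero    = f₀≈g₀
    Q-injective f g Qf≈Qg f₀≈g₀ (suc m) = begin
      X.coeff f (suc m)             ≈⟨ raise-Q f m ⟨
      X.coeff (raise (Q f)) (suc m) ≈⟨ φ-cong raise-linear (Q f) (Q g) Qf≈Qg (suc m) ⟩
      X.coeff (raise (Q g)) (suc m) ≈⟨ raise-Q g m ⟩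
      X.coeff g (suc m)             ∎

    raise-below : ∀ n f → DegreeBelow n f → DegreeBelow (suc n) (raise f)
    raise-below n f f<n m n<m = functional-unique-below
      (coeff-∘ raise-linear m) zero-functional n
      (λ k k<n → trans (raise-term k m) (below (suc k) m (ℕ.≤-<-trans k<n n<m)))
      f f<n

    -- Both sides are linear in `f`, so only `term p k` with `k ≤ n` matter: below `n` both sides
    -- vanish, and at `n` the factor `lead⁻¹ n` cancels `lead n`. The explicit factor is what shows
    -- that leading coefficients stay apart from zero.
    raise-lead : ∀ n f → DegreeBelow (suc n) f →
      X.coeff (raise f) (suc n) ≈ X.coeff f n * (lead⁻¹ n * lead (suc n))
    raise-lead n = functional-unique-below
      (coeff-∘ raise-linear (suc n)) (*ʳ-functional (coeff-functional n) _) (suc n) agree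
      where
      agree : ∀ k → k < suc n →
        X.coeff (raise (term p k)) (suc n) ≈ X.coeff (term p k) n * (lead⁻¹ n * lead (suc n))
      agree k k<1+n with ℕ.m≤n⇒m<n∨m≡n (ℕ.≤-pred k<1+n)
      ... | inj₁ k<n = begin
        X.coeff (raise (term p k)) (suc n)  ≈⟨ raise-term k (suc n) ⟩
        X.coeff (term p (suc k)) (suc n)    ≈⟨ below (suc k) (suc n) (s≤s k<n) ⟩
        0#                                  ≈⟨ zeroˡ _ ⟨
        0# * _                              ≈⟨ *-congʳ (below k n k<n) ⟨
        X.coeff (term p k) n * _            ∎
      ... | inj₂ ≡.refl = begin
        X.coeff (raise (term p n)) (suc n)  ≈⟨ raise-term n (suc n) ⟩
        lead (suc n)                        ≈⟨ *-identityˡ _ ⟨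
        1# * lead (suc n)                   ≈⟨ *-congʳ (lead*lead⁻¹ n) ⟨
        lead n * lead⁻¹ n * lead (suc n)    ≈⟨ *-assoc _ _ _ ⟩
        lead n * (lead⁻¹ n * lead (suc n))  ∎

    basicTerm : ℕ → K[x]
    basicTerm zero    = X.const 1#
    basicTerm (suc n) = centre (raise (basicTerm n))

    -- `raise` multiplies the leading coefficient by `lead⁻¹ n * lead (suc n)`, a product of
    -- elements apart from zero, and `centre` alters only the constant term.
    basicTerm-degree : ∀ n → HasDegree (basicTerm n) n
    basicTerm-degree zero = record
      { leading-nonzero = 1#0
      ; higher-zero     = λ where (suc m) _ → refl
      }
    basicTerm-degree (suc n) = record
      { leading-nonzero = #-congʳ
          (sym (trans (centre-suc (raise f) n) (raise-lead n f (HasDegree.higher-zero f-degree))))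
          (x#0y#0→xy#0 (HasDegree.leading-nonzero f-degree)
                       (x#0y#0→xy#0 (lead⁻¹#0 n) (lead#0 (suc n))))
      ; higher-zero     = λ where
          (suc m) 1+n<1+m → trans (centre-suc (raise f) m)
            (raise-below (suc n) f (HasDegree.higher-zero f-degree) (suc m) 1+n<1+m)
      }
      where
      f = basicTerm n
      f-degree = basicTerm-degree n

    basic : PolynomialSequence
    basic = record { term = basicTerm ; degree = basicTerm-degree }

    basic-normalised : IsNormalised basic
    basic-normalised = record
      { at-zero = eval-0 (X.const 1#)
      ; at-suc  = λ n → trans (eval-0 (basicTerm (suc n))) (centre-zero (raise (basicTerm n)))
      }

    basic-lowers : Lowers Q basic
    basic-lowers = record
      { lowers-suc  = λ n m → let f = raise (basicTerm n); b = X.const (- X.coeff f 0) in begin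
          X.coeff (Q (f X.+ b)) m              ≈⟨ +-homo (coeff-∘ Q-linear m) f b ⟩
          X.coeff (Q f) m + X.coeff (Q b) m    ≈⟨ +-cong (Q-raise (basicTerm n) m) (Q-const _ m) ⟩
          X.coeff (basicTerm n) m + 0#         ≈⟨ +-identityʳ _ ⟩
          X.coeff (basicTerm n) m              ∎
      ; lowers-zero = Q-const 1#
      }

    normalised-unique : ∀ {q q′} → IsNormalised q → Lowers Q q → IsNormalised q′ → Lowers Q q′ →
                        q ≗ₛ q′
    normalised-unique {q} {q′} q-norm q-low q′-norm q′-low = agree
      where
      constantTerms : ∀ n → X.coeff (term q n) 0 ≈ X.coeff (term q′ n) 0
      constantTerms n = trans (sym (eval-0 (term q n))) (trans (values n) (eval-0 (term q′ n)))
        where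
        values : ∀ n → X.eval (term q n) 0# ≈ X.eval (term q′ n) 0#
        values zero    = trans (IsNormalised.at-zero q-norm) (sym (IsNormalised.at-zero q′-norm))
        values (suc n) = trans (IsNormalised.at-suc q-norm n) (sym (IsNormalised.at-suc q′-norm n))
      agree : q ≗ₛ q′
      agree zero    = Q-injective (term q 0) (term q′ 0)
        (λ m → trans (Lowers.lowers-zero q-low m) (sym (Lowers.lowers-zero q′-low m)))
        (constantTerms 0)
      agree (suc n) = Q-injective (term q (suc n)) (term q′ (suc n))
        (λ m → trans (Lowers.lowers-suc q-low n m)
          (trans (agree n m) (sym (Lowers.lowers-suc q′-low n m))))
        (constantTerms (suc n))

    -- The series `G`.

    module Series (q : PolynomialSequence) where

      coeff₂-seriesTerm : ∀ f n j i → coeff₂ (seriesTerm Q q f n) j i ≈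
        X.coeff (term q n) j * X.coeff (iterate Q f n) i
      coeff₂-seriesTerm f n = coeff₂-inY*inX (term q n) (iterate Q f n)

      summand-vanishes : ∀ n f j i k → DegreeBelow n f → n ≤ k →
        X.coeff (term q k) j * X.coeff (iterate Q f k) i ≈ 0#
      summand-vanishes n f j i k f<n n≤k = trans
        (*-congˡ (iterate-vanishes k f (degreeBelow-mono f n≤k f<n) i)) (zeroʳ _)

      converges : ∀ f → FinitelySupported (seriesTerm Q q f)
      converges f = length f , λ n len≤n j i → trans (coeff₂-seriesTerm f n j i)
        (summand-vanishes (length f) f j i n (degreeBelow-length f) len≤n)

      G : K[x] → K[x,y]
      G f = infiniteSum (seriesTerm Q q f) (converges f)

      partialSum : ℕ → ℕ → ℕ → K[x] → Carrier
      partialSum j i n f = sum< n (λ k → X.coeff (term q k) j * X.coeff (iterate Q f k) i)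

      coeff₂-G : ∀ f j i → coeff₂ (G f) j i ≈ partialSum j i (length f) f
      coeff₂-G f j i = trans (coeff₂-sum {length f} (λ k → seriesTerm Q q f (toℕ k)) j i)
        (sum<-cong (length f) (λ k → coeff₂-seriesTerm f k j i))

      partialSum-stable : ∀ j i m n f → DegreeBelow m f → DegreeBelow n f →
        partialSum j i m f ≈ partialSum j i n f
      partialSum-stable j i m n f f<m f<n = sum<-stable m n _
        (λ k → summand-vanishes m f j i k f<m) (λ k → summand-vanishes n f j i k f<n)

      -- The cut-off in `G` varies with `f`, so linearity comes from partial sums of fixed length,
      -- which are linear and eventually agree with it.
      G-linear : IsLinear₂ G
      G-linear = linear₂ λ j i → functional-resp (λ f → coeff₂-G f j i)
        (functional-limit
          (λ n → sum-functional {n} (λ k → functional-resp (λ f → *-comm _ _)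
            (*ʳ-functional (coeff-∘ (iterate-linear Q-linear (toℕ k)) i) _)))
          (partialSum-stable j i))

      coeff₂-G-term : ∀ n j i → coeff₂ (G (term p n)) j i ≈
        sum {suc n} (λ k → X.coeff (term p (n ∸ toℕ k)) i * X.coeff (term q (toℕ k)) j)
      coeff₂-G-term n j i = begin
        coeff₂ (G (term p n)) j i
          ≈⟨ coeff₂-G (term p n) j i ⟩
        partialSum j i (length (term p n)) (term p n)
          -- Trailing zeros may make the list longer than `suc n`; the cut-off is moved to `suc n`
          -- to match the range of `convolution`.
          ≈⟨ partialSum-stable j i _ (suc n) (term p n) (degreeBelow-length (term p n)) (below n) ⟩
        partialSum j i (suc n) (term p n)
          ≈⟨ sum-cong-≋ {suc n} (λ k → trans (*-congˡ (iterate-term (toℕ≤pred[n] k) i))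
               (*-comm (X.coeff (term q (toℕ k)) j) _)) ⟩
        sum {suc n} (λ k → X.coeff (term p (n ∸ toℕ k)) i * X.coeff (term q (toℕ k)) j) ∎

      -- The operator `P` and the identity `F = P_y G`.

      module Umbral {P : K[x] → K[x]} (P-linear : IsLinear P)
                    (P-term : ∀ n → P (term q n) X.≈ term p n) where

        -- For a fixed power of `x`, `G (term p n)` is a linear combination of the `term q k` with
        -- coefficients taken from `term p (n ∸ k)`; `P` then turns each `term q k` into `term p k`.
        onY-G-term : ∀ n → onY P (G (term p n)) XY.≈ convolution p n
        onY-G-term n j i = begin
          coeff₂ (onY P (G (term p n))) j i
            ≈⟨ coeff₂-onY P-linear (G (term p n)) j i ⟩
          X.coeff (P (row i (G (term p n)))) j
            ≈⟨ φ-cong P-linear (row i (G (term p n))) (sumX scaled) row-sum j ⟩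
          X.coeff (P (sumX scaled)) j
            ≈⟨ sum-homo (coeff-∘ P-linear j) scaled ⟩
          sum (λ k → X.coeff (P (scaled k)) j)
            ≈⟨ sum-cong-≋ {suc n} (λ k → trans
                 (·-homo (coeff-∘ P-linear j) (X.coeff (term p (n ∸ toℕ k)) i) (term q (toℕ k)))
                 (*-congˡ (P-term (toℕ k) j))) ⟩
          sum {suc n} (λ k → X.coeff (term p (n ∸ toℕ k)) i * X.coeff (term p (toℕ k)) j)
            -- So far index `k` belongs to the factor in `y`; `convolution` attaches it to the
            -- factor in `x`.
            ≈⟨ sum-antidiagonal n (λ k l → X.coeff (term p k) i * X.coeff (term p l) j) ⟨
          sum {suc n} (λ k → X.coeff (term p (toℕ k)) i * X.coeff (term p (n ∸ toℕ k)) j)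
            ≈⟨ sum-cong-≋ {suc n}
                 (λ k → coeff₂-inX*inY (term p (toℕ k)) (term p (n ∸ toℕ k)) j i) ⟨
          sum {suc n} (λ k → coeff₂ (inX (term p (toℕ k)) XY.* inY (term p (n ∸ toℕ k))) j i)
            ≈⟨ coeff₂-sum {suc n} (λ k → inX (term p (toℕ k)) XY.* inY (term p (n ∸ toℕ k))) j i ⟨
          coeff₂ (convolution p n) j i ∎
          where
          scaled : Fin (suc n) → K[x]
          scaled k = X.coeff (term p (n ∸ toℕ k)) i X.· term q (toℕ k)
          row-sum : row i (G (term p n)) X.≈ sumX scaled
          row-sum l = begin
            X.coeff (row i (G (term p n))) l   ≈⟨ coeff-row i (G (term p n)) l ⟩
            coeff₂ (G (term p n)) l i          ≈⟨ coeff₂-G-term n l i ⟩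
            sum {suc n} (λ k → X.coeff (term p (n ∸ toℕ k)) i * X.coeff (term q (toℕ k)) l)
              ≈⟨ sum-cong-≋ {suc n} (λ k → coeff-· (X.coeff (term p (n ∸ toℕ k)) i) (term q (toℕ k)) l) ⟨
            sum {suc n} (λ k → X.coeff (scaled k) l)
              ≈⟨ sum-homo (coeff-functional l) scaled ⟨
            X.coeff (sumX scaled) l ∎

        -- On `term q (suc n)` both composites give `term p n`, since `Q` lowers `q` and `p` alike;
        -- on `term q 0` both give zero.
        commutes : Lowers Q q → (P ∘ Q) ≗ (Q ∘ P)
        commutes q-lowers = Basis.linear-unique q (linear-∘ P-linear Q-linear)
          (linear-∘ Q-linear P-linear) agree
          where
          agree : ∀ n → P (Q (term q n)) X.≈ Q (P (term q n))
          agree zero m = begin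
            X.coeff (P (Q (term q 0))) m
              ≈⟨ φ-cong P-linear (Q (term q 0)) [] (Lowers.lowers-zero q-lowers) m ⟩
            X.coeff (P []) m              ≈⟨ φ-[] P-linear m ⟩
            0#                            ≈⟨ lowers-zero m ⟨
            X.coeff (Q (term p 0)) m      ≈⟨ φ-cong Q-linear _ (term p 0) (P-term 0) m ⟨
            X.coeff (Q (P (term q 0))) m  ∎
          agree (suc n) m = begin
            X.coeff (P (Q (term q (suc n)))) m
              ≈⟨ φ-cong P-linear _ (term q n) (Lowers.lowers-suc q-lowers n) m ⟩
            X.coeff (P (term q n)) m            ≈⟨ P-term n m ⟩
            X.coeff (term p n) m                ≈⟨ lowers-suc n m ⟨
            X.coeff (Q (term p (suc n))) m
              ≈⟨ φ-cong Q-linear _ (term p (suc n)) (P-term (suc n)) m ⟨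
            X.coeff (Q (P (term q (suc n)))) m  ∎

        -- The two composites are compared with the identity on different bases: `P ∘ P⁻¹` on `p`
        -- and `P⁻¹ ∘ P` on `q`.
        invertible : IsInvertible P
        invertible = P⁻¹ , P⁻¹-linear ,
          -- `Inverseᵇ` allows any argument equal to the image, hence the extra congruence in each
          -- half.
          (λ {f} {g} g≈P⁻¹f n → trans (φ-cong P-linear g (P⁻¹ f) g≈P⁻¹f n) (P-P⁻¹ f n)) ,
          (λ {f} {g} g≈Pf n → trans (φ-cong P⁻¹-linear g (P f) g≈Pf n) (P⁻¹-P f n))
          where
          P⁻¹ : K[x] → K[x]
          P⁻¹ = extend (term q)
          P⁻¹-linear : IsLinear P⁻¹
          P⁻¹-linear = extend-linear (term q)
          P-P⁻¹ : ∀ f → P (P⁻¹ f) X.≈ f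
          P-P⁻¹ = linear-unique (linear-∘ P-linear P⁻¹-linear) id-linear λ n m →
            trans (φ-cong P-linear _ (term q n) (extend-term (term q) n) m) (P-term n m)
          P⁻¹-P : ∀ f → P⁻¹ (P f) X.≈ f
          P⁻¹-P = Basis.linear-unique q (linear-∘ P⁻¹-linear P-linear) id-linear λ n m →
            trans (φ-cong P⁻¹-linear (P (term q n)) (term p n) (P-term n) m) (extend-term (term q) n m)

  -- Assembly of the four statements.

  lowered : PolynomialSequence → ℕ → K[x]
  lowered p zero    = []
  lowered p (suc n) = term p n

theorem2 : ∀ {c ℓ₁ ℓ₂} (K : HeytingField c ℓ₁ ℓ₂) →
    let open PolynomialOperators K in
    CharacteristicZero →
    (p : PolynomialSequence) →
    let IsQ = λ (Q : K[x] → K[x]) → IsLinear Q × Lowers Q p in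
    ∃! _≗_ IsQ ×
    (∀ Q → IsQ Q →
    let Isq = λ (q : PolynomialSequence) → IsNormalised q × Lowers Q q in
    ∃! _≗ₛ_ Isq ×
    (∀ q → Isq q →
    let IsP = λ (P : K[x] → K[x]) → IsLinear P × (∀ n → P (term q n) X.≈ term p n) in
    ∃! _≗_ IsP ×
    (∀ P → IsP P →
    IsInvertible P ×
    ((P ∘ Q) ≗ (Q ∘ P)) ×
    (Σ[ converges ∈ (∀ f → FinitelySupported (seriesTerm Q q f)) ]
    let G   = λ (f : K[x]) → infiniteSum (seriesTerm Q q f) (converges f)
        IsF = λ (F : K[x] → K[x,y]) → IsLinear₂ F × (∀ n → F (term p n) XY.≈ convolution p n)
    in
    IsLinear₂ G ×
    ∃! _≗₂_ IsF ×
    (∀ F → IsF F → F ≗₂ (onY P ∘ G))))))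
theorem2 K _ p =
  ( extend K p (lowered K p)
  , ( extend-linear K p (lowered K p)
    , record { lowers-suc  = λ n → extend-term K p (lowered K p) (suc n)
             ; lowers-zero = extend-term K p (lowered K p) 0 })
  , λ {Q′} (Q′-linear , Q′-lowers) →
      linear-unique K p (extend-linear K p (lowered K p)) Q′-linear
        λ { zero    m → trans (extend-term K p (lowered K p) 0 m)
                              (sym (Lowers.lowers-zero Q′-lowers m))
          ; (suc n) m → trans (extend-term K p (lowered K p) (suc n) m)
                              (sym (Lowers.lowers-suc Q′-lowers n m)) } )
  -- From here on `Q`, and later `q` and `P`, are arbitrary objects satisfying the defining
  -- relations, not only the constructed ones.
  , λ Q (Q-linear , Q-lowers) →
    let open Lowering K p Q-linear Q-lowers in
    ( basic
    , (basic-normalised , basic-lowers)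
    , λ {q′} (q′-normalised , q′-lowers) →
        normalised-unique {basic} {q′} basic-normalised basic-lowers q′-normalised q′-lowers )
    , λ q (q-normalised , q-lowers) →
      let open Series q in
      -- The basis is now `q`, with the terms of `p` as prescribed values.
      ( extend K q (term p)
      , (extend-linear K q (term p) , extend-term K q (term p))
      , λ {P′} (P′-linear , P′-term) → linear-unique K q (extend-linear K q (term p)) P′-linear
          (λ n m → trans (extend-term K q (term p) n m) (sym (P′-term n m))) )
      , λ P (P-linear , P-term) →
        let open Umbral P-linear P-term
            F-linear = onY-linear₂ K P-linear G-linear
            F-unique = λ F (F-linear′ , F-term) → linear₂-unique K p F-linear′ F-linear
              (λ n j i → trans (F-term n j i) (sym (onY-G-term n j i)))
        in
        invertible , commutes q-lowers , converges , G-linear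
        , (onY P ∘ G , (F-linear , onY-G-term)
          -- `∃!` compares the constructed operator with the given one, the reverse of the final
          -- clause, hence the symmetry.
          , λ {F} isF f j i → sym (F-unique F isF f j i))
        , F-unique
  where
  open PolynomialOperators K
  open HeytingField K using (trans; sym)
  open Basis
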